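{- Let $E$ be an extended metric space and let $\mathcal{E}_E$ be the quantitative theory of exceptions over $E$. The monads $T_{\mathcal{E}_E}$ and $(-+E)$ on $\mathbf{Met}$ are isomorphic.
   Context: An extended metric space is a set $X$ with $d_X:X\times X\to[0,\infty]$ satisfying $d_X(x,y)=0$ iff $x=y$, symmetry and the triangle inequality. $\mathbf{Met}$ is the category of extended metric spaces and non-expansive maps. Quantitative theories. A signature $\Sigma$ is a set of function symbols $f:n$ of finite arity $n\in\mathbb{N}$. Fix a countably infinite set of variables $V$; terms are $\Sigma$-terms over $V$. A quantitative equation is an expression $t=_\varepsilon s$ with $t,s$ terms and $\varepsilon\in\mathbb{Q}_{\ge0}$. A conditional quantitative equation is $\Gamma\vdash t=_\varepsilon s$ with $\Gamma$ a finite set of quantitative equations. A quantitative equational theory of type $\Sigma$ is a set $\mathcal{U}$ of conditional quantitative equations containing (for all variables and rationals $\varepsilon,\varepsilon'\ge 0$) $\vdash x=_0x$; $\{x=_\varepsilon y\}\vdash y=_\varepsilon x$; $\{x=_\varepsilon z,z=_{\varepsilon'}y\}\vdash x=_{\varepsilon+\varepsilon'}y$; $\{x=_\varepsilon y\}\vdash x=_{\varepsilon+\varepsilon'}y$ for $\varepsilon'>0$; $\{x_i=_\varepsilon y_i\mid i=1,\dots,n\}\vdash f(x_1,\dots,x_n)=_\varepsilon f(y_1,\dots,y_n)$ for $f:n\in\Sigma$; and closed under: continuity (if $\Gamma\vdash t=_{\varepsilon'}s\in\mathcal{U}$ for all $\varepsilon'>\varepsilon$ then $\Gamma\vdash t=_\varepsilon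 s\in\mathcal{U}$), substitution of terms for variables, assumption ($\Gamma\vdash\phi\in\mathcal{U}$ whenever $\phi\in\Gamma$), and cut (if $\Gamma\vdash\phi\in\mathcal{U}$ for all $\phi\in\Theta$ and $\Theta\vdash\psi\in\mathcal{U}$ then $\Gamma\vdash\psi\in\mathcal{U}$). A set $A$ of conditional quantitative equations axiomatizes $\mathcal{U}$ if $\mathcal{U}$ is the smallest theory containing $A$. Models. A quantitative $\Sigma$-algebra is an extended metric space $A$ with, for each $f:n\in\Sigma$, a map $f^A:A^n\to A$ that is non-expansive for the max metric on $A^n$. It satisfies $\Gamma\vdash t=_\varepsilon s$ if for every assignment $\iota:V\to A$ (extended homomorphically to terms), $d_A(\iota(t'),\iota(s'))\le\varepsilon'$ for all $t'=_{\varepsilon'}s'\in\Gamma$ implies $d_A(\iota(t),\iota(s))\le\varepsilon$. $\mathbb{K}(\Sigma,\mathcal{U})$ is the category of quantitative $\Sigma$-algebras satisfying all members of $\mathcal{U}$, with non-expansive $\Sigma$-homomorphisms. The forgetful functor $\mathbb{K}(\Sigma,\mathcal{U})\to\mathbf{Met}$ has a left adjoint (known result); $T_{\mathcal{U}}$ denotes the induced monad on $\mathbf{Met}$. Exceptions. $\mathcal{E}_E$ has signature $\{\mathsf{raise}_e:0\mid e\in E\}$ and is axiomatized by $\vdash\mathsf{raise}_{e_1}=_\delta\mathsf{raise}_{e_2}$ for all $e_1,e_2\in E$ and $\delta\in\mathbb{Q}_{\ge0}$ with $\delta\ge d_E(e_1,e_2)$. The exception monad $(-+E)$ sends $X$ to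 the coproduct $X+E$ in $\mathbf{Met}$ (disjoint union, distance $\infty$ between the two components), with unit the left injection $X\to X+E$ and multiplication $[\mathrm{id}_{X+E},\mathrm{in}_r]:(X+E)+E\to X+E$. -}

module Defs where

open import Level using (Level; _⊔_) renaming (suc to lsuc)
open import Data.Empty.Polymorphic using (⊥)
open import Data.Fin.Base using (Fin; toℕ; _↑ˡ_; _↑ʳ_; fromℕ<)
import Data.Fin.Properties as Fin
open import Data.List.Base as List using (List; []; _∷_)
open import Data.List.Membership.Propositional using (_∈_)
open import Data.List.Membership.Propositional.Properties using (∈-tabulate⁻)
open import Data.List.Relation.Unary.Any using (here; there)
open import Data.Nat.Base using (ℕ; zero; suc)
import Data.Nat.Base as ℕ
import Data.Nat.Properties as ℕ
open import Data.Product.Base using (∃-syntax; _×_; _,_; proj₁; proj₂)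
open import Data.Rational.Base as ℚ using (ℚ; 0ℚ; NonNegative; nonNegative)
import Data.Rational.Properties as ℚ
open import Data.Sum.Base using (_⊎_; inj₁; inj₂; [_,_]′)
open import Data.Sum.Relation.Binary.Pointwise using (⊎-setoid; inj₁; inj₂)
open import Data.Unit.Polymorphic using (⊤; tt)
open import Data.Vec.Base as Vec using (Vec; []; _∷_; lookup)
import Data.Vec.Properties as Vec
open import Data.Vec.Relation.Binary.Pointwise.Inductive as Pointwise
  using (Pointwise; []; _∷_)
open import Function.Base using (id; _∘_)
open import Function.Bundles using (_⇔_; mk⇔; Equivalence)
open import Relation.Binary.Bundles using (Setoid)
open import Relation.Binary.Definitions using (tri<; tri≈; tri>)
open import Relation.Binary.PropositionalEquality as ≡ using (_≡_; refl)
open import Relation.Binary.Structures using (IsEquivalence)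
open import Relation.Nullary.Decidable.Core using (yes; no)
open import Relation.Nullary.Negation.Core using (contradiction)
open import Relation.Unary using (Pred)

private
  variable
    a ℓ : Level

record Category (o h e : Level) : Set (lsuc (o ⊔ h ⊔ e)) where
  infix  4 _⇒_ _≈_
  infixr 9 _∙_
  field
    Obj      : Set o
    _⇒_      : Obj → Obj → Set h
    _≈_      : ∀ {A B} → A ⇒ B → A ⇒ B → Set e
    idn      : ∀ {A} → A ⇒ A
    _∙_      : ∀ {A B C} → B ⇒ C → A ⇒ B → A ⇒ C
    isEquiv  : ∀ {A B} → IsEquivalence (_≈_ {A} {B})
    ∙-cong   : ∀ {A B C} {f g : B ⇒ C} {h k : A ⇒ B} →
               f ≈ g → h ≈ k → f ∙ h ≈ g ∙ k
    assoc    : ∀ {A B C D} (f : C ⇒ D) (g : B ⇒ C) (h : A ⇒ B) →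
               (f ∙ g) ∙ h ≈ f ∙ (g ∙ h)
    idˡ      : ∀ {A B} (f : A ⇒ B) → idn ∙ f ≈ f
    idʳ      : ∀ {A B} (f : A ⇒ B) → f ∙ idn ≈ f

  module ≈ {A B} = IsEquivalence (isEquiv {A} {B})

record Functor {o h e o′ h′ e′} (C : Category o h e) (D : Category o′ h′ e′) :
               Set (o ⊔ h ⊔ e ⊔ o′ ⊔ h′ ⊔ e′) where
  private
    module C = Category C
    module D = Category D
  field
    F₀     : C.Obj → D.Obj
    F₁     : ∀ {A B} → A C.⇒ B → F₀ A D.⇒ F₀ B
    F-cong : ∀ {A B} {f g : A C.⇒ B} → f C.≈ g → F₁ f D.≈ F₁ g
    F-id   : ∀ {A} → F₁ (C.idn {A}) D.≈ D.idn
    F-∙    : ∀ {A B C} (f : B C.⇒ C) (g : A C.⇒ B) →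
             F₁ (f C.∙ g) D.≈ F₁ f D.∙ F₁ g

open Functor

module _ {o h e o′ h′ e′} {C : Category o h e} {D : Category o′ h′ e′} where

  record NatTrans (F G : Functor C D) : Set (o ⊔ h ⊔ e ⊔ o′ ⊔ h′ ⊔ e′) where
    private
      module C = Category C
      module D = Category D
    field
      at      : ∀ A → F₀ F A D.⇒ F₀ G A
      natural : ∀ {A B} (f : A C.⇒ B) → at B D.∙ F₁ F f D.≈ F₁ G f D.∙ at A

open NatTrans

module _ {o h e} {C : Category o h e} where
  private module C = Category C

  Id : Functor C C
  Id = record
    { F₀ = id ; F₁ = id ; F-cong = id ; F-id = C.≈.refl
    ; F-∙ = λ _ _ → C.≈.refl }

infixr 9 _⊙_
_⊙_ : ∀ {o h e o′ h′ e′ o″ h″ e″} {C : Category o h e}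
      {D : Category o′ h′ e′} {E : Category o″ h″ e″} →
      Functor D E → Functor C D → Functor C E
_⊙_ {E = E} G F = record
  { F₀     = F₀ G ∘ F₀ F
  ; F₁     = F₁ G ∘ F₁ F
  ; F-cong = F-cong G ∘ F-cong F
  ; F-id   = E.≈.trans (F-cong G (F-id F)) (F-id G)
  ; F-∙    = λ f g → E.≈.trans (F-cong G (F-∙ F f g)) (F-∙ G _ _)
  }
  where module E = Category E

module _ {o h e o′ h′ e′} {C : Category o h e} {D : Category o′ h′ e′} where
  private
    module C = Category C
    module D = Category D

  record _⊣_ (L : Functor C D) (R : Functor D C) :
             Set (o ⊔ h ⊔ e ⊔ o′ ⊔ h′ ⊔ e′) where
    field
      unit   : NatTrans Id (R ⊙ L)
      counit : NatTrans (L ⊙ R) Id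
      zig    : ∀ A → at counit (F₀ L A) D.∙ F₁ L (at unit A) D.≈ D.idn
      zag    : ∀ B → F₁ R (at counit B) C.∙ at unit (F₀ R B) C.≈ C.idn

record Monad {o h e} (C : Category o h e) : Set (o ⊔ h ⊔ e) where
  private module C = Category C
  field
    T       : Functor C C
    η       : NatTrans Id T
    μ       : NatTrans (T ⊙ T) T
    μ-assoc : ∀ A → at μ A C.∙ F₁ T (at μ A) C.≈ at μ A C.∙ at μ (F₀ T A)
    μ-idˡ   : ∀ A → at μ A C.∙ F₁ T (at η A) C.≈ C.idn
    μ-idʳ   : ∀ A → at μ A C.∙ at η (F₀ T A) C.≈ C.idn

module _ {o h e} {C : Category o h e} where
  private module C = Category C

  record MonadMorphism (M N : Monad C) : Set (o ⊔ h ⊔ e) where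
    private
      module M = Monad M
      module N = Monad N
    field
      α   : NatTrans M.T N.T
      α-η : ∀ A → at α A C.∙ at M.η A C.≈ at N.η A
      α-μ : ∀ A → at α A C.∙ at M.μ A C.≈
                  at N.μ A C.∙ F₁ N.T (at α A) C.∙ at α (F₀ M.T A)

  infix 4 _≅_
  record _≅_ (M N : Monad C) : Set (o ⊔ h ⊔ e) where
    open MonadMorphism
    field
      to      : MonadMorphism M N
      from    : MonadMorphism N M
      from∙to : ∀ A → at (α from) A C.∙ at (α to) A C.≈ C.idn
      to∙from : ∀ A → at (α to) A C.∙ at (α from) A C.≈ C.idn

module _ {o h e o′ h′ e′} {C : Category o h e} {D : Category o′ h′ e′}
         {L : Functor C D} {R : Functor D C} where
  private
    module C = Category C
    module D = Category D

  inducedMonad : L ⊣ R → Monad C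
  inducedMonad adj = record
    { T       = R ⊙ L
    ; η       = unit
    ; μ       = record
      { at      = λ A → F₁ R (at counit (F₀ L A))
      ; natural = λ f → C.≈.trans (C.≈.sym (F-∙ R _ _))
                    (C.≈.trans (F-cong R (natural counit (F₁ L f)))
                               (F-∙ R _ _))
      }
    ; μ-assoc = λ A → C.≈.trans (C.≈.sym (F-∙ R _ _))
                  (C.≈.trans (F-cong R (natural counit (at counit (F₀ L A))))
                             (F-∙ R _ _))
    ; μ-idˡ   = λ A → C.≈.trans (C.≈.sym (F-∙ R _ _))
                  (C.≈.trans (F-cong R (zig A)) (F-id R))
    ; μ-idʳ   = λ A → zag (F₀ L A)
    }
    where open _⊣_ adj

record ℚ≥0 : Set where
  constructor mkℚ≥0
  field
    value       : ℚ
    .{{nonNeg}} : NonNegative value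

open ℚ≥0 using (value)

value-injective : ∀ {p q} → value p ≡ value q → p ≡ q
value-injective refl = refl

infix  4 _≤₊_ _<₊_
infixl 6 _+₊_

_≤₊_ _<₊_ : ℚ≥0 → ℚ≥0 → Set
p ≤₊ q = value p ℚ.≤ value q
p <₊ q = value p ℚ.< value q

0₊ : ℚ≥0
0₊ = mkℚ≥0 0ℚ

_+₊_ : ℚ≥0 → ℚ≥0 → ℚ≥0
mkℚ≥0 p +₊ mkℚ≥0 q = mkℚ≥0 (p ℚ.+ q) {{ℚ.nonNeg+nonNeg⇒nonNeg p q}}

0≤₊ : ∀ p → 0₊ ≤₊ p
0≤₊ (mkℚ≥0 p) = ℚ.nonNegative⁻¹ p

≤₊-split : ∀ p q → p ≤₊ q → p ≡ q ⊎ ∃[ r ] 0₊ <₊ r × q ≡ p +₊ r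
≤₊-split p q p≤q with ℚ.<-cmp (value p) (value q)
... | tri≈ _ p≡q _ = inj₁ (value-injective p≡q)
... | tri> _ _ q<p = contradiction (ℚ.<-≤-trans q<p p≤q) (ℚ.<-irrefl refl)
... | tri< p<q _ _ = inj₂ (r , 0<r , value-injective (≡.sym p+r≡q))
  where
  r′ : ℚ
  r′ = value q ℚ.- value p
  0<r : 0ℚ ℚ.< r′
  0<r = ≡.subst (ℚ._< r′) (ℚ.+-inverseʳ (value p))
          (ℚ.+-monoˡ-< (ℚ.- value p) p<q)
  r : ℚ≥0
  r = mkℚ≥0 r′ {{nonNegative (ℚ.<⇒≤ 0<r)}}
  p+r≡q : value p ℚ.+ r′ ≡ value q
  p+r≡q = ≡.trans (ℚ.+-comm (value p) r′)
            (≡.trans (ℚ.+-assoc (value q) _ _)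
              (≡.trans (≡.cong (value q ℚ.+_) (ℚ.+-inverseˡ (value p)))
                       (ℚ.+-identityʳ (value q))))

<₊-dense : ∀ p q → p <₊ q → ∃[ r ] p <₊ r × r <₊ q
<₊-dense p q p<q with ℚ.<-dense p<q
... | m , p<m , m<q =
  mkℚ≥0 m {{nonNegative (ℚ.≤-trans (0≤₊ p) (ℚ.<⇒≤ p<m))}} , p<m , m<q

-- The extended half-line [0,∞], as closed upper Dedekind cuts: r is given by
-- the set {ε ∈ ℚ≥0 ∣ r ≤ ε}.  The empty cut is ∞.
record [0,∞] (ℓ : Level) : Set (lsuc ℓ) where
  infix 4 _≤ℚ_
  field
    _≤ℚ_   : Pred ℚ≥0 ℓ
    upward : ∀ {ε ε′} → ε ≤₊ ε′ → _≤ℚ_ ε → _≤ℚ_ ε′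
    closed : ∀ {ε} → (∀ ε′ → ε <₊ ε′ → _≤ℚ_ ε′) → _≤ℚ_ ε

open [0,∞] public using (_≤ℚ_; upward; closed)

infix 4 _≤∞_ _≈∞_
_≤∞_ _≈∞_ : [0,∞] ℓ → [0,∞] ℓ → Set ℓ
r ≤∞ s = ∀ ε → s ≤ℚ ε → r ≤ℚ ε
r ≈∞ s = r ≤∞ s × s ≤∞ r

0∞ : [0,∞] ℓ
0∞ = record { _≤ℚ_ = λ _ → ⊤ ; upward = λ _ _ → tt ; closed = λ _ → tt }

∞ : [0,∞] ℓ
∞ = record
  { _≤ℚ_   = λ _ → ⊥
  ; upward = λ _ ()
  ; closed = λ {ε} all → all (ε +₊ 1₊)
      (≡.subst (ℚ._< value (ε +₊ 1₊)) (ℚ.+-identityʳ (value ε))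
        (ℚ.+-monoʳ-< (value ε) (ℚ.positive⁻¹ ℚ.1ℚ)))
  }
  where
  1₊ : ℚ≥0
  1₊ = mkℚ≥0 ℚ.1ℚ

-- r + s ≤ ε iff every rational ε′ > ε dominates a sum of rational upper bounds
-- of r and s (equality ε′ = ε need not be attained by rationals).
infixl 6 _+∞_
_+∞_ : [0,∞] ℓ → [0,∞] ℓ → [0,∞] ℓ
r +∞ s = record
  { _≤ℚ_   = λ ε → ∀ ε′ → ε <₊ ε′ →
               ∃[ p ] ∃[ q ] r ≤ℚ p × s ≤ℚ q × p +₊ q ≤₊ ε′
  ; upward = λ ε≤δ h ε′ δ<ε′ → h ε′ (ℚ.≤-<-trans ε≤δ δ<ε′)
  ; closed = λ {ε} h ε′ ε<ε′ →
      let δ , ε<δ , δ<ε′ = <₊-dense ε ε′ ε<ε′ in h δ ε<δ ε′ δ<ε′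
  }

sup∞ : ∀ {n} → (Fin n → [0,∞] ℓ) → [0,∞] ℓ
sup∞ r = record
  { _≤ℚ_   = λ ε → ∀ i → r i ≤ℚ ε
  ; upward = λ ε≤δ h i → upward (r i) ε≤δ (h i)
  ; closed = λ h i → closed (r i) (λ ε′ ε<ε′ → h ε′ ε<ε′ i)
  }

-- Equality of points is that of a setoid, so that quotients exist.  Congruence
-- of d is not a field because it follows from the laws.
record ExtMetricSpace (ℓ : Level) : Set (lsuc ℓ) where
  field
    setoid   : Setoid ℓ ℓ
  open Setoid setoid public using (Carrier; _≈_)
  module ≈ = Setoid setoid
  field
    d        : Carrier → Carrier → [0,∞] ℓ
    identity : ∀ x y → d x y ≈∞ 0∞ ⇔ x ≈ y
    symmetry : ∀ x y → d x y ≈∞ d y x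
    triangle : ∀ x y z → d x z ≤∞ d x y +∞ d y z

  d-zero : ∀ {x y} → x ≈ y → ∀ ε → d x y ≤ℚ ε
  d-zero {x} {y} x≈y ε = proj₁ (Equivalence.from (identity x y) x≈y) ε tt

  zero-d : ∀ {x y} → d x y ≤ℚ 0₊ → x ≈ y
  zero-d {x} {y} h = Equivalence.to (identity x y)
    ((λ ε _ → upward (d x y) (0≤₊ ε) h) , λ _ _ → tt)

record NonExpansive (X Y : ExtMetricSpace ℓ) : Set ℓ where
  private
    module X = ExtMetricSpace X
    module Y = ExtMetricSpace Y
  field
    fun    : X.Carrier → Y.Carrier
    nonExp : ∀ x y → Y.d (fun x) (fun y) ≤∞ X.d x y

  fun-cong : ∀ {x y} → x X.≈ y → fun x Y.≈ fun y
  fun-cong {x} {y} x≈y = Y.zero-d (nonExp x y 0₊ (X.d-zero x≈y 0₊))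

open NonExpansive

Met : (ℓ : Level) → Category (lsuc ℓ) ℓ ℓ
Met ℓ = record
  { Obj     = ExtMetricSpace ℓ
  ; _⇒_     = NonExpansive
  ; _≈_     = λ {_} {Y} f g → let open ExtMetricSpace Y in
                ∀ x → fun f x ≈ fun g x
  ; idn     = record { fun = id ; nonExp = λ _ _ _ → id }
  ; _∙_     = λ f g → record
      { fun    = fun f ∘ fun g
      ; nonExp = λ x y ε → nonExp f _ _ ε ∘ nonExp g x y ε }
  ; isEquiv = λ {_} {Y} → let open ExtMetricSpace Y in record
      { refl  = λ _ → ≈.refl
      ; sym   = λ p x → ≈.sym (p x)
      ; trans = λ p q x → ≈.trans (p x) (q x) }
  ; ∙-cong  = λ {_} {_} {Z} {f} {g} {h} {k} p q x →
      let open ExtMetricSpace Z in ≈.trans (fun-cong f (q x)) (p (fun k x))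
  ; assoc   = λ {_} {_} {_} {Z} _ _ _ _ → ExtMetricSpace.≈.refl Z
  ; idˡ     = λ {_} {Y} _ _ → ExtMetricSpace.≈.refl Y
  ; idʳ     = λ {_} {Y} _ _ → ExtMetricSpace.≈.refl Y
  }

infix 8 _^_
_^_ : ExtMetricSpace ℓ → ℕ → ExtMetricSpace ℓ
X ^ n = record
  { setoid   = Pointwise.setoid setoid n
  ; d        = λ xs ys → sup∞ (λ i → d (lookup xs i) (lookup ys i))
  ; identity = λ xs ys → mk⇔
      (λ p → ext xs ys (λ i → zero-d (proj₁ p 0₊ tt i)))
      (λ p → (λ ε _ i → d-zero (Pointwise.lookup p i) ε) , λ _ _ → tt)
  ; symmetry = λ xs ys →
      (λ ε h i → proj₁ (symmetry _ _) ε (h i)) ,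
      (λ ε h i → proj₂ (symmetry _ _) ε (h i))
  ; triangle = λ xs ys zs ε h i → triangle _ (lookup ys i) _ ε
      (λ ε′ ε<ε′ → let p , q , hp , hq , p+q≤ε′ = h ε′ ε<ε′ in
                   p , q , hp i , hq i , p+q≤ε′)
  }
  where
  open ExtMetricSpace X
  ext : ∀ {n} (xs ys : Vec Carrier n) →
        (∀ i → lookup xs i ≈ lookup ys i) → Pointwise _≈_ xs ys
  ext []       []       _ = []
  ext (x ∷ xs) (y ∷ ys) h = h Fin.zero ∷ ext xs ys (h ∘ Fin.suc)

record Signature (ℓ : Level) : Set (lsuc ℓ) where
  field
    Op    : Set ℓ
    arity : Op → ℕ

open Signature

data Term (Σ : Signature ℓ) (X : Set a) : Set (ℓ ⊔ a) where
  var : X → Term Σ X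
  op  : (f : Op Σ) → Vec (Term Σ X) (arity Σ f) → Term Σ X

module _ {Σ : Signature ℓ} {b} {X : Set a} {B : Set b}
         (ι : X → B) (⟦_⟧ : (f : Op Σ) → Vec B (arity Σ f) → B) where

  fold  : Term Σ X → B
  folds : ∀ {n} → Vec (Term Σ X) n → Vec B n
  fold (var x)   = ι x
  fold (op f ts) = ⟦ f ⟧ (folds ts)
  folds []       = []
  folds (t ∷ ts) = fold t ∷ folds ts

  folds≡map : ∀ {n} (ts : Vec (Term Σ X) n) → folds ts ≡ Vec.map fold ts
  folds≡map []       = refl
  folds≡map (t ∷ ts) = ≡.cong (fold t ∷_) (folds≡map ts)

V : Set
V = ℕ

infix 6 _=[_]_
record QuantEq (Σ : Signature ℓ) (X : Set a) : Set (ℓ ⊔ a) where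
  constructor _=[_]_
  field
    lhs   : Term Σ X
    bound : ℚ≥0
    rhs   : Term Σ X

-- A finite set of premises is given by a list enumerating it; order and
-- multiplicity are immaterial in a theory, by assumption and cut.
infix 4 _⊢_
record CondQuantEq (Σ : Signature ℓ) : Set ℓ where
  constructor _⊢_
  field
    premises   : List (QuantEq Σ V)
    conclusion : QuantEq Σ V

module _ {Σ : Signature ℓ} {b} {X : Set a} {Y : Set b} where

  _[_] : Term Σ X → (X → Term Σ Y) → Term Σ Y
  t [ σ ] = fold σ op t

  _[_]ₑ : QuantEq Σ X → (X → Term Σ Y) → QuantEq Σ Y
  (t =[ ε ] s) [ σ ]ₑ = t [ σ ] =[ ε ] s [ σ ]

record IsTheory (Σ : Signature ℓ) (𝒰 : Pred (CondQuantEq Σ) ℓ) : Set ℓ where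
  field
    reflexivity  : ∀ x → 𝒰 ([] ⊢ var x =[ 0₊ ] var x)
    symmetry     : ∀ x y ε →
                   𝒰 (var x =[ ε ] var y ∷ [] ⊢ var y =[ ε ] var x)
    triangle     : ∀ x y z ε ε′ →
                   𝒰 (var x =[ ε ] var z ∷ var z =[ ε′ ] var y ∷ []
                      ⊢ var x =[ ε +₊ ε′ ] var y)
    maximality   : ∀ x y ε ε′ → 0₊ <₊ ε′ →
                   𝒰 (var x =[ ε ] var y ∷ [] ⊢ var x =[ ε +₊ ε′ ] var y)
    nonExpansive : ∀ f (x y : Fin (arity Σ f) → V) ε →
                   𝒰 (List.tabulate (λ i → var (x i) =[ ε ] var (y i))
                      ⊢ op f (Vec.tabulate (var ∘ x))
                          =[ ε ] op f (Vec.tabulate (var ∘ y)))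
    continuity   : ∀ Γ t s ε →
                   (∀ ε′ → ε <₊ ε′ → 𝒰 (Γ ⊢ t =[ ε′ ] s)) →
                   𝒰 (Γ ⊢ t =[ ε ] s)
    substitution : ∀ (σ : V → Term Σ V) Γ φ → 𝒰 (Γ ⊢ φ) →
                   𝒰 (List.map _[ σ ]ₑ Γ ⊢ φ [ σ ]ₑ)
    assumption   : ∀ Γ φ → φ ∈ Γ → 𝒰 (Γ ⊢ φ)
    cut          : ∀ Γ Θ ψ → (∀ φ → φ ∈ Θ → 𝒰 (Γ ⊢ φ)) → 𝒰 (Θ ⊢ ψ) →
                   𝒰 (Γ ⊢ ψ)

record Theory (Σ : Signature ℓ) : Set (lsuc ℓ) where
  field
    Member   : Pred (CondQuantEq Σ) ℓ
    isTheory : IsTheory Σ Member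
  open IsTheory isTheory public

data Generated {Σ : Signature ℓ} (𝒜 : Pred (CondQuantEq Σ) ℓ) :
               Pred (CondQuantEq Σ) ℓ where
  axiom        : ∀ {c} → 𝒜 c → Generated 𝒜 c
  reflexivity  : ∀ x → Generated 𝒜 ([] ⊢ var x =[ 0₊ ] var x)
  symmetry     : ∀ x y ε →
                 Generated 𝒜 (var x =[ ε ] var y ∷ [] ⊢ var y =[ ε ] var x)
  triangle     : ∀ x y z ε ε′ →
                 Generated 𝒜 (var x =[ ε ] var z ∷ var z =[ ε′ ] var y ∷ []
                              ⊢ var x =[ ε +₊ ε′ ] var y)
  maximality   : ∀ x y ε ε′ → 0₊ <₊ ε′ →
                 Generated 𝒜 (var x =[ ε ] var y ∷ []
                              ⊢ var x =[ ε +₊ ε′ ] var y)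
  nonExpansive : ∀ f (x y : Fin (arity Σ f) → V) ε →
                 Generated 𝒜 (List.tabulate (λ i → var (x i) =[ ε ] var (y i))
                              ⊢ op f (Vec.tabulate (var ∘ x))
                                  =[ ε ] op f (Vec.tabulate (var ∘ y)))
  continuity   : ∀ Γ t s ε →
                 (∀ ε′ → ε <₊ ε′ → Generated 𝒜 (Γ ⊢ t =[ ε′ ] s)) →
                 Generated 𝒜 (Γ ⊢ t =[ ε ] s)
  substitution : ∀ (σ : V → Term Σ V) Γ φ → Generated 𝒜 (Γ ⊢ φ) →
                 Generated 𝒜 (List.map _[ σ ]ₑ Γ ⊢ φ [ σ ]ₑ)
  assumption   : ∀ Γ φ → φ ∈ Γ → Generated 𝒜 (Γ ⊢ φ)
  cut          : ∀ Γ Θ ψ → (∀ φ → φ ∈ Θ → Generated 𝒜 (Γ ⊢ φ)) →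
                 Generated 𝒜 (Θ ⊢ ψ) → Generated 𝒜 (Γ ⊢ ψ)

axiomatizedBy : {Σ : Signature ℓ} → Pred (CondQuantEq Σ) ℓ → Theory Σ
axiomatizedBy 𝒜 = record
  { Member   = Generated 𝒜
  ; isTheory = record { Generated } }

Generated-least : {Σ : Signature ℓ} {𝒜 𝒰 : Pred (CondQuantEq Σ) ℓ} →
                  IsTheory Σ 𝒰 → (∀ {c} → 𝒜 c → 𝒰 c) →
                  ∀ {c} → Generated 𝒜 c → 𝒰 c
Generated-least {𝒜 = 𝒜} {𝒰} th 𝒜⊆𝒰 = go
  where
  module U = IsTheory th
  go : ∀ {c} → Generated 𝒜 c → 𝒰 c
  go (axiom p)                = 𝒜⊆𝒰 p
  go (reflexivity x)          = U.reflexivity x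
  go (symmetry x y ε)         = U.symmetry x y ε
  go (triangle x y z ε ε′)    = U.triangle x y z ε ε′
  go (maximality x y ε ε′ p)  = U.maximality x y ε ε′ p
  go (nonExpansive f x y ε)   = U.nonExpansive f x y ε
  go (continuity Γ t s ε h)   = U.continuity Γ t s ε (λ ε′ p → go (h ε′ p))
  go (substitution σ Γ φ p)   = U.substitution σ Γ φ (go p)
  go (assumption Γ φ p)       = U.assumption Γ φ p
  go (cut Γ Θ ψ h p)          = U.cut Γ Θ ψ (λ φ q → go (h φ q)) (go p)

record QuantAlgebra (Σ : Signature ℓ) : Set (lsuc ℓ) where
  field
    space  : ExtMetricSpace ℓ
    interp : (f : Op Σ) → NonExpansive (space ^ arity Σ f) space
  open ExtMetricSpace space public

  ⟦_⟧ : (f : Op Σ) → Vec Carrier (arity Σ f) → Carrier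
  ⟦ f ⟧ = fun (interp f)

  eval : {X : Set a} → (X → Carrier) → Term Σ X → Carrier
  eval ι = fold ι ⟦_⟧

  Holds : {X : Set a} → (X → Carrier) → QuantEq Σ X → Set ℓ
  Holds ι (t =[ ε ] s) = d (eval ι t) (eval ι s) ≤ℚ ε

  Satisfies : CondQuantEq Σ → Set ℓ
  Satisfies (Γ ⊢ φ) = ∀ (ι : V → Carrier) →
    (∀ ψ → ψ ∈ Γ → Holds ι ψ) → Holds ι φ

record Homomorphism {Σ : Signature ℓ} (A B : QuantAlgebra Σ) : Set ℓ where
  private
    module A = QuantAlgebra A
    module B = QuantAlgebra B
  field
    map  : NonExpansive A.space B.space
    homo : ∀ f xs → fun map (A.⟦ f ⟧ xs) B.≈ B.⟦ f ⟧ (Vec.map (fun map) xs)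

open Homomorphism

record Model (Σ : Signature ℓ) (𝒰 : Theory Σ) : Set (lsuc ℓ) where
  field
    algebra   : QuantAlgebra Σ
    satisfies : ∀ c → Theory.Member 𝒰 c → QuantAlgebra.Satisfies algebra c
  open QuantAlgebra algebra public

𝕂 : (Σ : Signature ℓ) → Theory Σ → Category (lsuc ℓ) ℓ ℓ
𝕂 {ℓ} Σ 𝒰 = record
  { Obj     = Model Σ 𝒰
  ; _⇒_     = λ A B → Homomorphism (Model.algebra A) (Model.algebra B)
  ; _≈_     = λ f g → map f M.≈ map g
  ; idn     = λ {A} → let open Model A in record
      { map  = M.idn
      ; homo = λ f xs → ≈.reflexive (≡.cong ⟦ f ⟧ (≡.sym (Vec.map-id xs))) }
  ; _∙_     = λ {_} {_} {C} g h → let open Model C in record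
      { map  = map g M.∙ map h
      ; homo = λ f xs → ≈.trans (fun-cong (map g) (homo h f xs))
          (≈.trans (homo g f _)
            (≈.reflexive (≡.cong ⟦ f ⟧
              (≡.sym (Vec.map-∘ (fun (map g)) (fun (map h)) xs))))) }
  ; isEquiv = λ {A} {B} → let module E = IsEquivalence
                                (M.isEquiv {Model.space A} {Model.space B})
                          in record
      { refl  = λ {f} → E.refl {map f}
      ; sym   = λ {f} {g} → E.sym {map f} {map g}
      ; trans = λ {f} {g} {h} → E.trans {map f} {map g} {map h} }
  ; ∙-cong  = λ {_} {_} {_} {f} {g} {h} {k} →
      M.∙-cong {f = map f} {map g} {map h} {map k}
  ; assoc   = λ f g h → M.assoc (map f) (map g) (map h)
  ; idˡ     = λ f → M.idˡ (map f)
  ; idʳ     = λ f → M.idʳ (map f)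
  }
  where module M = Category (Met ℓ)

Forget : (Σ : Signature ℓ) (𝒰 : Theory Σ) → Functor (𝕂 Σ 𝒰) (Met ℓ)
Forget Σ 𝒰 = record
  { F₀     = Model.space
  ; F₁     = map
  ; F-cong = id
  ; F-id   = λ {A} _ → Model.≈.refl A
  ; F-∙    = λ {_} {_} {C} _ _ _ → Model.≈.refl C
  }

module FreeModel (Σ : Signature ℓ) (𝒰 : Theory Σ) (X : ExtMetricSpace ℓ) where
  private
    module X = ExtMetricSpace X
    module 𝒰 = Theory 𝒰

    infix 4 ⊩_
  -- Equations between terms over X derivable from the distances of X and 𝒰.
  data ⊩_ : QuantEq Σ X.Carrier → Set ℓ where
    dist  : ∀ {x y ε} → X.d x y ≤ℚ ε → ⊩ var x =[ ε ] var y
    inst  : ∀ {Γ φ} → 𝒰.Member (Γ ⊢ φ) → (σ : V → Term Σ X.Carrier) →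
            (∀ ψ → ψ ∈ Γ → ⊩ ψ [ σ ]ₑ) → ⊩ φ [ σ ]ₑ
    limit : ∀ {t s ε} → (∀ ε′ → ε <₊ ε′ → ⊩ t =[ ε′ ] s) → ⊩ t =[ ε ] s

  private
    T = Term Σ X.Carrier

    seq : T → T → T → V → T
    seq t s u 0             = t
    seq t s u 1             = s
    seq t s u (suc (suc _)) = u

    ⊩-refl : ∀ t → ⊩ t =[ 0₊ ] t
    ⊩-refl t = inst (𝒰.reflexivity 0) (λ _ → t) (λ _ ())

    ⊩-sym : ∀ {t s ε} → ⊩ t =[ ε ] s → ⊩ s =[ ε ] t
    ⊩-sym {t} {s} {ε} p = inst (𝒰.symmetry 0 1 ε) (seq t s s)
      λ { _ (here refl) → p ; _ (there ()) }

    ⊩-trans : ∀ {t s u ε ε′} → ⊩ t =[ ε ] s → ⊩ s =[ ε′ ] u →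
              ⊩ t =[ ε +₊ ε′ ] u
    ⊩-trans {t} {s} {u} {ε} {ε′} p q =
      inst (𝒰.triangle 0 2 1 ε ε′) (seq t s u)
        λ { _ (here refl) → p ; _ (there (here refl)) → q
          ; _ (there (there ())) }

    ⊩-upward : ∀ {t s ε ε′} → ε ≤₊ ε′ → ⊩ t =[ ε ] s → ⊩ t =[ ε′ ] s
    ⊩-upward {t} {s} {ε} {ε′} ε≤ε′ p with ≤₊-split ε ε′ ε≤ε′
    ... | inj₁ refl = p
    ... | inj₂ (r , 0<r , refl) = inst (𝒰.maximality 0 1 ε r 0<r) (seq t s s)
      λ { _ (here refl) → p ; _ (there ()) }

    nth : ∀ {n} → T → Vec T n → V → T
    nth {n} t ts k with k ℕ.<? n
    ... | yes k<n = lookup ts (fromℕ< k<n)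
    ... | no  _   = t

    nth-toℕ : ∀ {n} t (ts : Vec T n) i → nth t ts (toℕ i) ≡ lookup ts i
    nth-toℕ {n} t ts i with toℕ i ℕ.<? n
    ... | yes p = ≡.cong (lookup ts) (Fin.fromℕ<-toℕ i p)
    ... | no ¬p = contradiction (Fin.toℕ<n i) ¬p

    folds-var : ∀ {n} (σ : V → T) (x : Fin n → V) (ts : Vec T n) →
                (∀ i → σ (x i) ≡ lookup ts i) →
                folds {Σ = Σ} σ op (Vec.tabulate (var ∘ x)) ≡ ts
    folds-var σ x []       h = refl
    folds-var σ x (t ∷ ts) h =
      ≡.cong₂ _∷_ (h Fin.zero) (folds-var σ (x ∘ Fin.suc) ts (h ∘ Fin.suc))

    ⊩-op : ∀ f (ts ss : Vec T (arity Σ f)) {ε} →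
           (∀ i → ⊩ lookup ts i =[ ε ] lookup ss i) →
           ⊩ op f ts =[ ε ] op f ss
    ⊩-op f ts ss {ε} h =
      ≡.subst₂ (λ us vs → ⊩ op f us =[ ε ] op f vs)
        (folds-var σ x ts σx) (folds-var σ y ss σy)
        (inst (𝒰.nonExpansive f x y ε) σ premise)
      where
      n = arity Σ f
      x y : Fin n → V
      x i = toℕ (i ↑ˡ n)
      y i = toℕ (n ↑ʳ i)
      σ : V → T
      σ = nth (op f ts) (ts Vec.++ ss)
      σx : ∀ i → σ (x i) ≡ lookup ts i
      σx i = ≡.trans (nth-toℕ _ (ts Vec.++ ss) (i ↑ˡ n))
                     (Vec.lookup-++ˡ ts ss i)
      σy : ∀ i → σ (y i) ≡ lookup ss i
      σy i = ≡.trans (nth-toℕ _ (ts Vec.++ ss) (n ↑ʳ i))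
                     (Vec.lookup-++ʳ ts ss i)
      premise : ∀ ψ → ψ ∈ List.tabulate (λ i → var (x i) =[ ε ] var (y i)) →
                ⊩ ψ [ σ ]ₑ
      premise ψ ψ∈ with ∈-tabulate⁻ ψ∈
      ... | i , refl = ≡.subst₂ (λ u v → ⊩ u =[ ε ] v)
                         (≡.sym (σx i)) (≡.sym (σy i)) (h i)

  space : ExtMetricSpace ℓ
  space = record
    { setoid   = record
      { Carrier       = T
      ; _≈_           = λ t s → ⊩ t =[ 0₊ ] s
      ; isEquivalence = record
        { refl  = ⊩-refl _
        ; sym   = ⊩-sym
        ; trans = ⊩-trans }
      }
    ; d        = λ t s → record
      { _≤ℚ_   = λ ε → ⊩ t =[ ε ] s
      ; upward = ⊩-upward
      ; closed = limit }
    ; identity = λ t s → mk⇔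
        (λ p → proj₁ p 0₊ tt)
        (λ p → (λ ε _ → ⊩-upward {t} {s} {0₊} {ε} (0≤₊ ε) p) , λ _ _ → tt)
    ; symmetry = λ _ _ → (λ _ → ⊩-sym) , (λ _ → ⊩-sym)
    ; triangle = λ t s u ε h → limit λ ε′ ε<ε′ →
        let p , q , tp , sq , p+q≤ε′ = h ε′ ε<ε′ in
        ⊩-upward p+q≤ε′ (⊩-trans tp sq)
    }

  algebra : QuantAlgebra Σ
  algebra = record
    { space  = space
    ; interp = λ f → record
      { fun    = op f
      ; nonExp = λ ts ss ε → ⊩-op f ts ss }
    }

  model : Model Σ 𝒰
  model = record
    { algebra   = algebra
    ; satisfies = λ _ c∈𝒰 σ premises → inst c∈𝒰 σ premises
    }

  unit : NonExpansive X space
  unit = record { fun = var ; nonExp = λ _ _ _ → dist }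

  module _ (A : Model Σ 𝒰) where
    private module A = Model A

    module _ (g : NonExpansive X A.space) where
      private
        eval-[] : ∀ (σ : V → T) t →
          A.eval (A.eval (fun g) ∘ σ) t ≡ A.eval (fun g) (t [ σ ])
        evals-[] : ∀ (σ : V → T) {n} (ts : Vec (Term Σ V) n) →
          folds (A.eval (fun g) ∘ σ) A.⟦_⟧ ts ≡
          folds (fun g) A.⟦_⟧ (folds {Σ = Σ} σ op ts)
        eval-[] σ (var x)     = refl
        eval-[] σ (op f ts)   = ≡.cong A.⟦ f ⟧ (evals-[] σ ts)
        evals-[] σ []         = refl
        evals-[] σ (t ∷ ts)   = ≡.cong₂ _∷_ (eval-[] σ t) (evals-[] σ ts)

        sound : ∀ {φ} → ⊩ φ → A.Holds (fun g) φ
        sound (dist p)  = nonExp g _ _ _ p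
        sound (limit h) = closed (A.d _ _) (λ ε′ ε<ε′ → sound (h ε′ ε<ε′))
        sound (inst {Γ} {t =[ ε ] s} c∈𝒰 σ h) =
          ≡.subst₂ (λ a b → A.d a b ≤ℚ ε) (eval-[] σ t) (eval-[] σ s)
            (A.satisfies _ c∈𝒰 (A.eval (fun g) ∘ σ)
              (λ { (t′ =[ ε′ ] s′) ψ∈ →
                ≡.subst₂ (λ a b → A.d a b ≤ℚ ε′)
                  (≡.sym (eval-[] σ t′)) (≡.sym (eval-[] σ s′))
                  (sound (h _ ψ∈)) }))

      extend : Homomorphism algebra A.algebra
      extend = record
        { map  = record { fun = A.eval (fun g) ; nonExp = λ _ _ _ → sound }
        ; homo = λ f ts → A.≈.reflexive
            (≡.cong A.⟦ f ⟧ (folds≡map (fun g) A.⟦_⟧ ts))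
        }

    extend-unique : (h k : Homomorphism algebra A.algebra) →
      (∀ x → fun (map h) (var x) A.≈ fun (map k) (var x)) →
      ∀ t → fun (map h) t A.≈ fun (map k) t
    extend-unique h k h≈k = go
      where
      go : ∀ t → fun (map h) t A.≈ fun (map k) t
      gos : ∀ {n} (ts : Vec T n) →
            Pointwise A._≈_ (Vec.map (fun (map h)) ts)
                            (Vec.map (fun (map k)) ts)
      go (var x)   = h≈k x
      go (op f ts) = A.≈.trans (homo h f ts)
        (A.≈.trans (fun-cong (A.interp f) (gos ts)) (A.≈.sym (homo k f ts)))
      gos []       = []
      gos (t ∷ ts) = go t ∷ gos ts

module _ {ℓ} (Σ : Signature ℓ) (𝒰 : Theory Σ) where
  private
    module M = Category (Met ℓ)
    module K = Category (𝕂 Σ 𝒰)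
    module Fr = FreeModel Σ 𝒰

    bind : ∀ {X Y} → NonExpansive X Y → Fr.model X K.⇒ Fr.model Y
    bind {X} {Y} g = Fr.extend X (Fr.model Y) (Fr.unit Y M.∙ g)

    unique : ∀ {X} A (h k : Fr.model X K.⇒ A) →
             map h M.∙ Fr.unit X M.≈ map k M.∙ Fr.unit X → map h M.≈ map k
    unique {X} = Fr.extend-unique X

  Free : Functor (Met ℓ) (𝕂 Σ 𝒰)
  Free = record
    { F₀     = Fr.model
    ; F₁     = bind
    ; F-cong = λ {_} {Y} {f} {g} f≈g → unique (Fr.model Y) (bind f) (bind g)
        (λ x → fun-cong (Fr.unit Y) (f≈g x))
    ; F-id   = λ {X} → unique (Fr.model X) (bind M.idn) (K.idn {Fr.model X})
        (λ x → Model.≈.refl (Fr.model X))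
    ; F-∙    = λ {X} {Y} {Z} f g →
        unique (Fr.model Z) (bind (f M.∙ g))
          (K._∙_ {Fr.model X} {Fr.model Y} {Fr.model Z} (bind f) (bind g))
          (λ x → Model.≈.refl (Fr.model Z))
    }

  Free⊣Forget : Free ⊣ Forget Σ 𝒰
  Free⊣Forget = record
    { unit   = record
      { at      = Fr.unit
      ; natural = λ {_} {Y} f x → Model.≈.refl (Fr.model Y) }
    ; counit = record
      { at      = counit
      ; natural = λ {A} {B} f →
          unique B
            (K._∙_ {FU A} {FU B} {B} (counit B) (bind (map f)))
            (K._∙_ {FU A} {A} {B} f (counit A))
            (λ x → Model.≈.refl B) }
    ; zig    = λ X → unique (Fr.model X)
        (K._∙_ {Fr.model X} {FU (Fr.model X)} {Fr.model X}
          (counit (Fr.model X)) (bind (Fr.unit X)))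
        (K.idn {Fr.model X})
        (λ x → Model.≈.refl (Fr.model X))
    ; zag    = λ A x → Model.≈.refl A
    }
    where
    FU : K.Obj → K.Obj
    FU A = Fr.model (Model.space A)
    counit : ∀ A → FU A K.⇒ A
    counit A = Fr.extend (Model.space A) A M.idn

  𝕋 : Monad (Met ℓ)
  𝕋 = inducedMonad Free⊣Forget

module _ {ℓ} (E : ExtMetricSpace ℓ) where
  private module E = ExtMetricSpace E

  ExceptionSig : Signature ℓ
  ExceptionSig = record { Op = E.Carrier ; arity = λ _ → 0 }

  raise : E.Carrier → {X : Set a} → Term ExceptionSig X
  raise e = op e []

  data ExceptionAxiom : Pred (CondQuantEq ExceptionSig) ℓ where
    raise= : ∀ e₁ e₂ δ → E.d e₁ e₂ ≤ℚ δ →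
             ExceptionAxiom ([] ⊢ raise e₁ =[ δ ] raise e₂)

  ℰ : Theory ExceptionSig
  ℰ = axiomatizedBy ExceptionAxiom

infixl 6 _⊕_
_⊕_ : ExtMetricSpace ℓ → ExtMetricSpace ℓ → ExtMetricSpace ℓ
_⊕_ {ℓ} X Y = record
  { setoid   = ⊎-setoid X.setoid Y.setoid
  ; d        = dist
  ; identity = λ
    { (inj₁ x) (inj₁ x′) → mk⇔
        (inj₁ ∘ Equivalence.to (X.identity x x′))
        (λ { (inj₁ p) → Equivalence.from (X.identity x x′) p })
    ; (inj₂ y) (inj₂ y′) → mk⇔
        (inj₂ ∘ Equivalence.to (Y.identity y y′))
        (λ { (inj₂ p) → Equivalence.from (Y.identity y y′) p })
    ; (inj₁ _) (inj₂ _)  → mk⇔ (λ p → absurd (proj₁ p 0₊ tt)) λ ()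
    ; (inj₂ _) (inj₁ _)  → mk⇔ (λ p → absurd (proj₁ p 0₊ tt)) λ ()
    }
  ; symmetry = λ
    { (inj₁ x) (inj₁ x′) → X.symmetry x x′
    ; (inj₂ y) (inj₂ y′) → Y.symmetry y y′
    ; (inj₁ _) (inj₂ _)  → (λ _ ()) , (λ _ ())
    ; (inj₂ _) (inj₁ _)  → (λ _ ()) , (λ _ ())
    }
  ; triangle = tri
  }
  where
  module X = ExtMetricSpace X
  module Y = ExtMetricSpace Y

  absurd : ∀ {b} {B : Set b} → ⊥ {ℓ} → B
  absurd ()

  dist : X.Carrier ⊎ Y.Carrier → X.Carrier ⊎ Y.Carrier → [0,∞] ℓ
  dist (inj₁ x) (inj₁ x′) = X.d x x′
  dist (inj₂ y) (inj₂ y′) = Y.d y y′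
  dist (inj₁ _) (inj₂ _)  = ∞
  dist (inj₂ _) (inj₁ _)  = ∞

  ∞+ : ∀ s r → r ≤∞ ∞ {ℓ} +∞ s
  ∞+ s r ε h = absurd (closed ∞ {ε} λ ε′ ε<ε′ →
    let _ , _ , p , _ = h ε′ ε<ε′ in p)

  +∞∞ : ∀ s r → r ≤∞ s +∞ ∞ {ℓ}
  +∞∞ s r ε h = absurd (closed ∞ {ε} λ ε′ ε<ε′ →
    let _ , _ , _ , q , _ = h ε′ ε<ε′ in q)

  tri : ∀ u v w → dist u w ≤∞ dist u v +∞ dist v w
  tri (inj₁ x) (inj₁ y) (inj₁ z) = X.triangle x y z
  tri (inj₂ x) (inj₂ y) (inj₂ z) = Y.triangle x y z
  tri (inj₁ x) (inj₁ y) (inj₂ z) = +∞∞ (X.d x y) ∞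
  tri (inj₂ x) (inj₂ y) (inj₁ z) = +∞∞ (Y.d x y) ∞
  tri (inj₁ x) (inj₂ y) (inj₁ z) = ∞+ ∞ (X.d x z)
  tri (inj₂ x) (inj₁ y) (inj₂ z) = ∞+ ∞ (Y.d x z)
  tri (inj₁ x) (inj₂ y) (inj₂ z) = ∞+ (Y.d y z) ∞
  tri (inj₂ x) (inj₁ y) (inj₁ z) = ∞+ (X.d y z) ∞

module _ (X Y : ExtMetricSpace ℓ) where

  inˡ : NonExpansive X (X ⊕ Y)
  inˡ = record { fun = inj₁ ; nonExp = λ _ _ _ → id }

  inʳ : NonExpansive Y (X ⊕ Y)
  inʳ = record { fun = inj₂ ; nonExp = λ _ _ _ → id }

module _ {X Y Z : ExtMetricSpace ℓ} where

  copair : NonExpansive X Z → NonExpansive Y Z → NonExpansive (X ⊕ Y) Z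
  copair f g = record
    { fun    = [ fun f , fun g ]′
    ; nonExp = λ
      { (inj₁ x) (inj₁ x′) → nonExp f x x′
      ; (inj₂ y) (inj₂ y′) → nonExp g y y′
      ; (inj₁ _) (inj₂ _)  → λ _ ()
      ; (inj₂ _) (inj₁ _)  → λ _ ()
      }
    }

module _ {ℓ} (E : ExtMetricSpace ℓ) where
  private
    module M = Category (Met ℓ)
    module S (X : ExtMetricSpace ℓ) = ExtMetricSpace (X ⊕ E)

  -⊕_ : Functor (Met ℓ) (Met ℓ)
  -⊕_ = record
    { F₀     = _⊕ E
    ; F₁     = λ {X} {Y} f → copair (inˡ Y E M.∙ f) (inʳ Y E)
    ; F-cong = λ {_} {Y} → λ
        { p (inj₁ x) → inj₁ (p x) ; p (inj₂ e) → S.≈.refl Y }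
    ; F-id   = λ {X} → λ
        { (inj₁ _) → S.≈.refl X ; (inj₂ _) → S.≈.refl X }
    ; F-∙    = λ {_} {_} {Z} f g → λ
        { (inj₁ _) → S.≈.refl Z ; (inj₂ _) → S.≈.refl Z }
    }

  ExceptionMonad : Monad (Met ℓ)
  ExceptionMonad = record
    { T       = -⊕_
    ; η       = record
      { at      = λ X → inˡ X E
      ; natural = λ {_} {Y} f x → S.≈.refl Y }
    ; μ       = record
      { at      = λ X → copair M.idn (inʳ X E)
      ; natural = λ {_} {Y} f → λ
          { (inj₁ (inj₁ _)) → S.≈.refl Y
          ; (inj₁ (inj₂ _)) → S.≈.refl Y
          ; (inj₂ _)        → S.≈.refl Y }
      }
    ; μ-assoc = λ X → λ
        { (inj₁ (inj₁ _)) → S.≈.refl X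
        ; (inj₁ (inj₂ _)) → S.≈.refl X
        ; (inj₂ _)        → S.≈.refl X }
    ; μ-idˡ   = λ X → λ { (inj₁ _) → S.≈.refl X ; (inj₂ _) → S.≈.refl X }
    ; μ-idʳ   = λ X x → S.≈.refl X
    }

{-# OPTIONS --safe #-}

-- X + E, with raise e interpreted as the constant e, is a model of the theory
-- of exceptions.  Since the operations are nullary, a term over X is a
-- variable or some raise e, so evaluating terms in this model is a bijection
-- T X → X + E.  Its inverse is non-expansive: the distances of X and the
-- axioms of the theory are exactly what bounds the distances of X + E.
module Submission where

open import Defs

open import Data.Fin.Base using (Fin)
open import Data.List.Membership.Propositional.Properties using (∈-map⁺; ∈-tabulate⁺)
open import Data.List.Relation.Unary.Any using (here; there)
open import Data.Product.Base using (proj₁; _,_)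
import Data.Rational.Base as ℚ
import Data.Rational.Properties as ℚ
open import Data.Sum.Base using (inj₁; inj₂)
open import Data.Vec.Base as Vec using (Vec; []; _∷_; lookup)
open import Function.Base using (_∘_)
open import Level using (Level)
open import Relation.Binary.PropositionalEquality as ≡ using (_≡_; refl)

private
  variable
    a ℓ : Level

p≤₊p+₊q : ∀ p q → p ≤₊ p +₊ q
p≤₊p+₊q p q = ≡.subst (ℚ._≤ ℚ≥0.value (p +₊ q))
  (ℚ.+-identityʳ (ℚ≥0.value p)) (ℚ.+-monoʳ-≤ (ℚ≥0.value p) (0≤₊ q))

module _ {Σ : Signature ℓ} (A : QuantAlgebra Σ) where
  private module A = QuantAlgebra A
  open A hiding (symmetry; triangle)

  module _ {b} {X : Set a} {Y : Set b} (ι : Y → Carrier) (σ : X → Term Σ Y) where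

    -- Induction on terms, mutual with argument vectors. It allows an instance under `σ` to be
    -- judged by changing the assignment from `ι` to `eval ι ∘ σ`.
    eval-[] : ∀ t → eval (eval ι ∘ σ) t ≡ eval ι (t [ σ ])
    evals-[] : ∀ {n} (ts : Vec (Term Σ X) n) →
      folds (eval ι ∘ σ) ⟦_⟧ ts ≡ folds ι ⟦_⟧ (folds {Σ = Σ} σ op ts)
    eval-[] (var x)   = refl
    eval-[] (op f ts) = ≡.cong ⟦ f ⟧ (evals-[] ts)
    evals-[] []       = refl
    evals-[] (t ∷ ts) = ≡.cong₂ _∷_ (eval-[] t) (evals-[] ts)

    Holds-[]⁺ : ∀ φ → Holds (eval ι ∘ σ) φ → Holds ι (φ [ σ ]ₑ)
    Holds-[]⁺ (t =[ ε ] s) =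
      ≡.subst₂ (λ u v → d u v ≤ℚ ε) (eval-[] t) (eval-[] s)

    Holds-[]⁻ : ∀ φ → Holds ι (φ [ σ ]ₑ) → Holds (eval ι ∘ σ) φ
    Holds-[]⁻ (t =[ ε ] s) =
      ≡.subst₂ (λ u v → d u v ≤ℚ ε) (≡.sym (eval-[] t)) (≡.sym (eval-[] s))

  -- Lets the `i`-th premise of the non-expansiveness scheme bound the `i`-th coordinate, which is
  -- what the supremum metric on argument tuples asks for.
  lookup-folds-tabulate : ∀ {X : Set a} (ι : X → Carrier) {n} (x : Fin n → X) i →
    lookup (folds {Σ = Σ} ι ⟦_⟧ (Vec.tabulate (var ∘ x))) i ≡ ι (x i)
  lookup-folds-tabulate ι x Fin.zero    = refl
  lookup-folds-tabulate ι x (Fin.suc i) = lookup-folds-tabulate ι (x ∘ Fin.suc) i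

  -- Soundness. A generated theory is the least one containing its axioms, so an algebra is a model
  -- as soon as it satisfies the axioms.
  Satisfies-isTheory : IsTheory Σ Satisfies
  Satisfies-isTheory = record
    { reflexivity  = λ x ι _ → d-zero ≈.refl 0₊
    ; symmetry     = λ x y ε ι h → proj₁ (A.symmetry _ _) ε (h _ (here refl))
    -- The same pair `ε`, `ε′` of bounds serves every `δ` above their sum.
    ; triangle     = λ x y z ε ε′ ι h → A.triangle _ (ι z) _ (ε +₊ ε′) λ δ lt →
        ε , ε′ , h _ (here refl) , h _ (there (here refl)) , ℚ.<⇒≤ lt
    ; maximality   = λ x y ε ε′ _ ι h →
        upward (d _ _) (p≤₊p+₊q ε ε′) (h _ (here refl))
    ; nonExpansive = λ f x y ε ι h → NonExpansive.nonExp (interp f) _ _ ε λ i →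
        ≡.subst₂ (λ u v → d u v ≤ℚ ε)
          (≡.sym (lookup-folds-tabulate ι x i))
          (≡.sym (lookup-folds-tabulate ι y i))
          (h _ (∈-tabulate⁺ i))
    ; continuity   = λ Γ t s ε h ι p → closed (d _ _) λ ε′ lt → h ε′ lt ι p
    ; substitution = λ σ Γ φ h ι p → Holds-[]⁺ ι σ φ
        (h _ λ ψ ψ∈Γ → Holds-[]⁻ ι σ ψ (p _ (∈-map⁺ _[ σ ]ₑ ψ∈Γ)))
    ; assumption   = λ Γ φ φ∈Γ ι p → p φ φ∈Γ
    ; cut          = λ Γ Θ ψ h k ι p → k ι λ φ φ∈Θ → h φ φ∈Θ ι p
    }

module _ {ℓ} (E X : ExtMetricSpace ℓ) where
  private
    module E = ExtMetricSpace E
    module F = FreeModel (ExceptionSig E) (ℰ E) X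

  ⊕-algebra : QuantAlgebra (ExceptionSig E)
  ⊕-algebra = record
    { space  = X ⊕ E
    ; interp = λ e → record
      { fun    = λ _ → inj₂ e
      ; nonExp = λ _ _ ε _ → E.d-zero E.≈.refl ε }
    }

  ⊕-model : Model (ExceptionSig E) (ℰ E)
  ⊕-model = record
    { algebra   = ⊕-algebra
    ; satisfies = λ _ → Generated-least (Satisfies-isTheory ⊕-algebra)
        -- Both constants evaluate into the right summand, whose distance is that of `E`, so the
        -- side condition of the axiom is the required bound.
        λ { (raise= _ _ _ h) _ _ → h }
    }

  evaluate : NonExpansive F.space (X ⊕ E)
  evaluate = Homomorphism.map (F.extend ⊕-model (inˡ X E))

  raising : NonExpansive E F.space
  raising = record
    { fun    = λ e → raise E e
    ; nonExp = λ e₁ e₂ ε h →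
        -- The axiom is closed and has no premises, so any substitution would do.
        F.inst (axiom (raise= e₁ e₂ ε h)) (λ _ → raise E e₁) (λ _ ())
    }

  -- Only distances within a summand have to be bounded: across the two the distance is ∞.
  reify : NonExpansive (X ⊕ E) F.space
  reify = copair F.unit raising

theorem4p1 : ∀ {ℓ} (E : ExtMetricSpace ℓ) →
    𝕋 (ExceptionSig E) (ℰ E) ≅ ExceptionMonad E
theorem4p1 E = record
  { to      = record
    { α   = record
      { at      = evaluate E
      ; natural = λ {_} {Y} f → λ
          { (var _) → S.≈.refl Y ; (op _ []) → S.≈.refl Y } }
    ; α-η = λ X _ → S.≈.refl X
    ; α-μ = λ X → λ { (var _) → S.≈.refl X ; (op _ []) → S.≈.refl X }
    }
  ; from    = record
    { α   = record
      { at      = reify E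
      ; natural = λ {_} {Y} f → λ
          { (inj₁ _) → T.≈.refl Y ; (inj₂ _) → T.≈.refl Y } }
    ; α-η = λ X _ → T.≈.refl X
    -- An inner exception becomes a variable holding `raise E e`, which the multiplication unwraps;
    -- an outer one is a constant, kept by homomorphisms.
    ; α-μ = λ X → λ
        { (inj₁ (inj₁ _)) → T.≈.refl X
        ; (inj₁ (inj₂ _)) → T.≈.refl X
        ; (inj₂ _)        → T.≈.refl X }
    }
  ; from∙to = λ X → λ { (var _) → T.≈.refl X ; (op _ []) → T.≈.refl X }
  ; to∙from = λ X → λ { (inj₁ _) → S.≈.refl X ; (inj₂ _) → S.≈.refl X }
  }
  where
  module S X = ExtMetricSpace (X ⊕ E)
  module T X = ExtMetricSpace (FreeModel.space (ExceptionSig E) (ℰ E) X)
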